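{- Let $\Gamma_1=(V_1,E_1),\dots,\Gamma_t=(V_t,E_t)$ be $t\ge 1$ edge-regular graphs, each with parameters $(v,k,\lambda)$, on pairwise disjoint vertex sets, such that $vt=(\lambda+2)(k+1)$ and such that each $\Gamma_i$ admits a spread of $1$-regular cocliques $C_{i,1},\dots,C_{i,k+1}$. Let $\pi_1=\mathrm{id},\pi_2,\dots,\pi_t$ be permutations of $\{1,\dots,k+1\}$, and let $\Gamma=F_{(\pi_2,\dots,\pi_t)}(\Gamma_1,\dots,\Gamma_t)$. Suppose that either (a) $t\ge 2$ and the graphs $\Gamma_i$ are not complete, or (b) $t=1$ and $\Gamma_1$ has two vertices at distance at least $3$ that do not lie in the same coclique $C_{1,j}$. Then $\Gamma$ is a strictly Neumaier graph (with parameters $(vt,\,k+\lambda+1,\,\lambda;\,1,\,\lambda+2)$).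
   Context: All graphs are finite, simple, undirected. A regular graph is $\lambda$-edge-regular if it has at least one edge and any two adjacent vertices have exactly $\lambda$ common neighbours; it is $\mu$-co-edge-regular if it is not complete and any two distinct non-adjacent vertices have exactly $\mu$ common neighbours. An edge-regular graph with parameters $(v,k,\lambda)$ has $v$ vertices, is $k$-regular and $\lambda$-edge-regular. A graph is strongly regular if it is both edge-regular and co-edge-regular. A set $S$ of vertices is $e$-regular ($e>0$) if every vertex outside $S$ has exactly $e$ neighbours in $S$; a coclique is a set of pairwise non-adjacent vertices. A spread is a partition of the vertex set. A Neumaier graph with parameters $(v,k,\lambda;e,s)$ is a non-complete edge-regular graph with parameters $(v,k,\lambda)$ containing an $e$-regular clique of size $s$; it is strictly Neumaier if it is not strongly regular. Construction $F$: given graphs $\Gamma_1,\dots,\Gamma_t$ on disjoint vertex sets $V_1,\dots,V_t$, each with a spread of $1$-regular cocliques $C_{i,1},\dots,C_{i,m}$, and permutations $\pi_1=\mathrm{id},\pi_2,\dots,\pi_t$ of $\{1,\dots,m\}$, the graph $F_{(\pi_2,\dots,\pi_t)}(\Gamma_1,\dots,\Gamma_t)$ has vertex set $V_1\cup\dots\cup V_t$, and two distinct vertices $x\in C_{i,k'}$, $y\in C_{j,l'}$ are adjacent iff either ($i=j$ and $x\sim y$ in $\Gamma_i$) or $\pi_i^{ -1}(k')=\pi_j^{ -1}(l')$. (Equivalently, each set $C_{1,r}\cup C_{2,\pi_2(r)}\cup\dots\cup C_{t,\pi_t(r)}$ is made into a clique.)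
   Formalization: The formal theorem additionally assumes that the graphs Γ_i are not all disjoint unions of complete graphs; without this the claim fails, e.g. for t=2 and Γ_1=Γ_2=2K_4, where Γ is the strongly regular 4×4 grid. -}

module Defs where

open import Data.Fin using (Fin; remQuot)
open import Data.Fin.Permutation using (Permutation′; _⟨$⟩ˡ_)
open import Data.Fin.Properties using (_≟_; any?)
open import Data.Fin.Subset using (Subset; _∈_; _∉_; _∩_; ∣_∣; Nonempty)
open import Data.Fin.Subset.Properties using (_∈?_)
open import Data.Nat using (ℕ; zero; suc; _*_; _≤_; _>_)
open import Data.Product using (_×_; _,_; ∃; ∃₂; ∃!; ∃-syntax)
open import Data.Product.Properties using (≡-dec)
open import Data.Sum using (_⊎_; inj₁; inj₂)
open import Data.Vec using (tabulate)
open import Level using (0ℓ)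
open import Relation.Binary.Core using (Rel)
open import Relation.Binary.Definitions using (Decidable; Symmetric; Irreflexive)
open import Relation.Binary.PropositionalEquality using (_≡_; _≢_; refl; sym)
open import Relation.Nullary using (does; ¬_; ¬?; _×-dec_; _⊎-dec_)

private
  variable
    n m : ℕ

record Graph (n : ℕ) : Set₁ where
  infix 4 _∼_ _∼?_
  field
    _∼_      : Rel (Fin n) 0ℓ
    _∼?_     : Decidable _∼_
    ∼-sym    : Symmetric _∼_
    ∼-irrefl : Irreflexive _≡_ _∼_

open Graph public using () renaming (_∼_ to Adj; _∼?_ to Adj?)

N : Graph n → Fin n → Subset n
N Γ x = tabulate λ y → does (Adj? Γ x y)

degree : Graph n → Fin n → ℕ
degree Γ x = ∣ N Γ x ∣

commonNeighbours : Graph n → Fin n → Fin n → ℕ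
commonNeighbours Γ x y = ∣ N Γ x ∩ N Γ y ∣

data Walk (Γ : Graph n) : Fin n → Fin n → ℕ → Set where
  stop : ∀ {x} → Walk Γ x x zero
  step : ∀ {x y z d} → Adj Γ x y → Walk Γ y z d → Walk Γ x z (suc d)

-- Vertices in different connected components are at infinite distance, so
-- they are at distance at least d for every d.
DistanceAtLeast : ℕ → (Γ : Graph n) → Fin n → Fin n → Set
DistanceAtLeast d Γ x y = ∀ {e} → Walk Γ x y e → d ≤ e

IsComplete : Graph n → Set
IsComplete Γ = ∀ x y → x ≢ y → Adj Γ x y

-- Every connected component is a complete graph.
IsDisjointUnionOfCompleteGraphs : Graph n → Set
IsDisjointUnionOfCompleteGraphs Γ =
  ∀ x y → x ≢ y → (∃[ d ] Walk Γ x y d) → Adj Γ x y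

IsRegular : Graph n → ℕ → Set
IsRegular Γ k = ∀ x → degree Γ x ≡ k

-- Edge-regular with parameters (v, k, λ); v is the index of the type of Γ.
record IsEdgeRegular {v : ℕ} (Γ : Graph v) (k lam : ℕ) : Set where
  field
    regular : IsRegular Γ k
    hasEdge : ∃₂ λ x y → Adj Γ x y
    common  : ∀ x y → Adj Γ x y → commonNeighbours Γ x y ≡ lam

record IsCoEdgeRegular {v : ℕ} (Γ : Graph v) (mu : ℕ) : Set where
  field
    regular     : ∃[ k ] IsRegular Γ k
    notComplete : ¬ IsComplete Γ
    common      : ∀ x y → x ≢ y → ¬ Adj Γ x y → commonNeighbours Γ x y ≡ mu

IsStronglyRegular : Graph n → Set
IsStronglyRegular Γ =
  (∃₂ λ k lam → IsEdgeRegular Γ k lam) × (∃[ mu ] IsCoEdgeRegular Γ mu)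

IsClique : Graph n → Subset n → Set
IsClique Γ S = ∀ x y → x ∈ S → y ∈ S → x ≢ y → Adj Γ x y

IsCoclique : Graph n → Subset n → Set
IsCoclique Γ S = ∀ x y → x ∈ S → y ∈ S → ¬ Adj Γ x y

IsRegularSet : Graph n → ℕ → Subset n → Set
IsRegularSet Γ e S = e > 0 × (∀ x → x ∉ S → ∣ N Γ x ∩ S ∣ ≡ e)

IsPartition : (Fin m → Subset n) → Set
IsPartition C = (∀ j → Nonempty (C j)) × (∀ x → ∃! _≡_ λ j → x ∈ C j)

IsSpreadOfRegularCocliques : Graph n → ℕ → (Fin m → Subset n) → Set
IsSpreadOfRegularCocliques Γ e C =
  IsPartition C × (∀ j → IsCoclique Γ (C j) × IsRegularSet Γ e (C j))

-- Neumaier with parameters (v, k, λ; e, s); v is the index of the type of Γ.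
record IsNeumaier {v : ℕ} (Γ : Graph v) (k lam e s : ℕ) : Set where
  field
    notComplete   : ¬ IsComplete Γ
    edgeRegular   : IsEdgeRegular Γ k lam
    regularClique : ∃[ S ] (IsClique Γ S × IsRegularSet Γ e S × ∣ S ∣ ≡ s)

IsStrictlyNeumaier : {v : ℕ} → Graph v → (k lam e s : ℕ) → Set
IsStrictlyNeumaier Γ k lam e s = IsNeumaier Γ k lam e s × ¬ IsStronglyRegular Γ

-- The pair (a , i) stands for the vertex a of Γ i, which makes the vertex sets
-- of the graphs Γ i disjoint.
module _ {v t m : ℕ} (Γ : Fin t → Graph v) (C : Fin t → Fin m → Subset v)
         (π : Fin t → Permutation′ m) where

  FAdj : Rel (Fin v × Fin t) 0ℓ
  FAdj (a , i) (b , j) =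
    (a , i) ≢ (b , j) ×
    ((i ≡ j × Adj (Γ i) a b) ⊎
     (∃₂ λ k′ l′ → a ∈ C i k′ × b ∈ C j l′ × π i ⟨$⟩ˡ k′ ≡ π j ⟨$⟩ˡ l′))

  FAdj? : Decidable FAdj
  FAdj? (a , i) (b , j) =
    ¬? (≡-dec _≟_ _≟_ (a , i) (b , j)) ×-dec
    ((i ≟ j ×-dec Adj? (Γ i) a b) ⊎-dec
     any? λ k′ → any? λ l′ →
       a ∈? C i k′ ×-dec b ∈? C j l′ ×-dec π i ⟨$⟩ˡ k′ ≟ π j ⟨$⟩ˡ l′)

  FAdj-sym : Symmetric FAdj
  FAdj-sym (ne , inj₁ (refl , e)) =
    (λ p → ne (sym p)) , inj₁ (refl , Graph.∼-sym (Γ _) e)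
  FAdj-sym (ne , inj₂ (k′ , l′ , a∈ , b∈ , eq)) =
    (λ p → ne (sym p)) , inj₂ (l′ , k′ , b∈ , a∈ , sym eq)

  -- The bijection remQuot t : Fin (v * t) → Fin v × Fin t
  -- transports FAdj to a graph on Fin (v * t).
  F : Graph (v * t)
  F = record
    { _∼_      = λ x y → FAdj (remQuot t x) (remQuot t y)
    ; _∼?_     = λ x y → FAdj? (remQuot t x) (remQuot t y)
    ; ∼-sym    = FAdj-sym
    ; ∼-irrefl = λ { refl (ne , _) → ne refl }
    }

{-# OPTIONS --safe #-}
-- The merged cocliques form a spread of the disjoint union G of the graphs Γ i,
-- so that only the case of one graph G has to be treated.  Between two cocliques
-- of the spread the edges of G form a perfect matching; hence all cocliques have
-- the same size, which is λ + 2 by counting vertices.  Non-adjacent vertices of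
-- the merged graph have exactly two more common neighbours than they have in G.
-- If the merged graph is strongly regular, then μ = 2 as witnessed by a pair
-- without common neighbours in G, so that adjacency in G is transitive.
module Submission where

open import Defs
open import Data.Bool using (true)
open import Data.Fin using (Fin; zero; suc; fromℕ<; remQuot; combine)
open import Data.Fin.Permutation
  using (Permutation′; _≈_; id; _⟨$⟩ˡ_; _⟨$⟩ʳ_; inverseˡ; inverseʳ)
open import Data.Fin.Properties
  using (_≟_; nonZeroIndex; remQuot-combine; combine-injectiveˡ; combine-injectiveʳ;
         combine-remQuot; suc-injective)
open import Data.Fin.Subset
  using (Subset; _∈_; _∉_; _⊆_; _∩_; _∪_; ∁; _-_; ∣_∣; ⁅_⁆; ⊤; ⊥; Nonempty; inside; outside)
open import Data.Fin.Subset.Properties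
open import Data.Nat using (ℕ; zero; suc; _+_; _*_; _≤_; _<_; z≤n; s≤s)
open import Data.Nat.Properties as ℕ
  using (≤-refl; ≤-trans; ≤-antisym; ≤-<-trans; n≮n; +-suc; +-assoc; +-comm; m+1+n≰m)
open import Data.Product using (_×_; _,_; proj₁; proj₂; ∃₂; ∃-syntax; uncurry)
open import Data.Sum using (_⊎_; inj₁; inj₂; [_,_]′)
open import Data.Vec using (tabulate; []; _∷_; here; there)
open import Data.Vec.Properties using (lookup∘tabulate; lookup⇒[]=; []=⇒lookup)
open import Function using (_∘_)
open import Level using (0ℓ)
open import Relation.Binary.PropositionalEquality
  using (_≡_; _≢_; refl; sym; trans; cong; cong₂; subst; subst₂; module ≡-Reasoning)
open import Relation.Nullary using (¬_; Dec; yes; no; does; contradiction; _×-dec_)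
open import Relation.Nullary.Decidable using (dec-true)
open import Relation.Unary using (Pred; Decidable)

private
  variable
    m n : ℕ

-- Counting elements of finite subsets.

module _ {P : Pred (Fin n) 0ℓ} (P? : Decidable P) where

  ∈-tabulate⁺ : ∀ {x} → P x → x ∈ tabulate (λ y → does (P? y))
  ∈-tabulate⁺ {x} Px =
    lookup⇒[]= x _ (trans (lookup∘tabulate _ x) (dec-true (P? x) Px))

  ∈-tabulate⁻ : ∀ {x} → x ∈ tabulate (λ y → does (P? y)) → P x
  ∈-tabulate⁻ {x} x∈ = true⇒ (P? x) (trans (sym (lookup∘tabulate _ x)) ([]=⇒lookup x∈))
    where
    true⇒ : ∀ {A : Set} (a? : Dec A) → does a? ≡ true → A
    true⇒ (yes a) _ = a

x∈p⇒∣p∣>0 : ∀ {x} {p : Subset n} → x ∈ p → 0 < ∣ p ∣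
x∈p⇒∣p∣>0 x∈p = ≤-<-trans z≤n (x∈p⇒∣p-x∣<∣p∣ x∈p)

∣p∣≡1⇒Nonempty : ∀ {p : Subset n} → ∣ p ∣ ≡ 1 → Nonempty p
∣p∣≡1⇒Nonempty {n} {p} ∣p∣≡1 with nonempty? p
... | yes ne = ne
... | no empty with () ← trans (sym ∣p∣≡1) (trans (cong ∣_∣ (Empty-unique empty)) (∣⊥∣≡0 n))

∣p∣≡1⇒unique : ∀ {x y} {p : Subset n} → ∣ p ∣ ≡ 1 → x ∈ p → y ∈ p → x ≡ y
∣p∣≡1⇒unique {x = x} {y} {p} ∣p∣≡1 x∈p y∈p with y ≟ x
... | yes y≡x = sym y≡x
... | no  y≢x = contradiction
  (≤-<-trans (x∈p⇒∣p∣>0 (x∈p∧x≢y⇒x∈p-y y∈p y≢x))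
             (subst (∣ p - x ∣ <_) ∣p∣≡1 (x∈p⇒∣p-x∣<∣p∣ x∈p)))
  (n≮n 1)

∣p∪q∣≡∣p∣+∣q∣ : ∀ (p q : Subset n) → (∀ {x} → x ∈ p → x ∉ q) → ∣ p ∪ q ∣ ≡ ∣ p ∣ + ∣ q ∣
∣p∪q∣≡∣p∣+∣q∣ []            []            disj = refl
∣p∪q∣≡∣p∣+∣q∣ (outside ∷ p) (outside ∷ q) disj =
  ∣p∪q∣≡∣p∣+∣q∣ p q λ x∈p x∈q → disj (there x∈p) (there x∈q)
∣p∪q∣≡∣p∣+∣q∣ (outside ∷ p) (inside ∷ q)  disj =
  trans (cong suc (∣p∪q∣≡∣p∣+∣q∣ p q λ x∈p x∈q → disj (there x∈p) (there x∈q)))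
        (sym (+-suc ∣ p ∣ ∣ q ∣))
∣p∪q∣≡∣p∣+∣q∣ (inside ∷ p)  (outside ∷ q) disj =
  cong suc (∣p∪q∣≡∣p∣+∣q∣ p q λ x∈p x∈q → disj (there x∈p) (there x∈q))
∣p∪q∣≡∣p∣+∣q∣ (inside ∷ p)  (inside ∷ q)  disj = contradiction here (disj here)

∣⁅x⁆∪p∣≡1+∣p∣ : ∀ {x} (p : Subset n) → x ∉ p → ∣ ⁅ x ⁆ ∪ p ∣ ≡ suc ∣ p ∣
∣⁅x⁆∪p∣≡1+∣p∣ {x = x} p x∉p =
  trans (∣p∪q∣≡∣p∣+∣q∣ ⁅ x ⁆ p λ y∈ → subst (_∉ p) (sym (x∈⁅y⁆⇒x≡y x y∈)) x∉p)
        (cong (_+ ∣ p ∣) (∣⁅x⁆∣≡1 x))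

-- Induction on `p`: the partner of the first element is removed from `q`, and injectivity keeps it
-- from serving any later element. A relation replaces a function because partners exist only for
-- members of `p` and need not be unique.
injective-relation⇒∣p∣≤∣q∣ :
  (R : Fin n → Fin m → Set) (p : Subset n) (q : Subset m) →
  (∀ {x} → x ∈ p → ∃[ y ] (y ∈ q × R x y)) →
  (∀ {x x′ y} → x ∈ p → x′ ∈ p → R x y → R x′ y → x ≡ x′) →
  ∣ p ∣ ≤ ∣ q ∣
injective-relation⇒∣p∣≤∣q∣ R []            q total inj = z≤n
injective-relation⇒∣p∣≤∣q∣ R (outside ∷ p) q total inj =
  injective-relation⇒∣p∣≤∣q∣ (R ∘ suc) p q (λ x∈ → total (there x∈))
    λ x∈ x′∈ r r′ → suc-injective (inj (there x∈) (there x′∈) r r′)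
injective-relation⇒∣p∣≤∣q∣ R (inside ∷ p) q total inj with total here
... | y₀ , y₀∈q , r₀ = ≤-trans
  (s≤s (injective-relation⇒∣p∣≤∣q∣ (R ∘ suc) p (q - y₀) total′
    λ x∈ x′∈ r r′ → suc-injective (inj (there x∈) (there x′∈) r r′)))
  (x∈p⇒∣p-x∣<∣p∣ y₀∈q)
  where
  total′ : ∀ {x} → x ∈ p → ∃[ y ] (y ∈ q - y₀ × R (suc x) y)
  total′ x∈p with total (there x∈p)
  ... | y , y∈q , r = y , x∈p∧x≢y⇒x∈p-y y∈q y≢y₀ , r
    where
    y≢y₀ : y ≢ y₀
    y≢y₀ refl with () ← inj here (there x∈p) r₀ r

-- Induction on the number of parts, splitting off the first one. The set `p` is arbitrary rather
-- than `⊤` so that the hypotheses pass on to what is left of it.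
∣p∣-partition :
  ∀ {c} (S : Fin m → Subset n) (p : Subset n) →
  (∀ r → ∣ S r ∣ ≡ c) → (∀ r → S r ⊆ p) → (∀ {x} → x ∈ p → ∃[ r ] x ∈ S r) →
  (∀ {x r s} → x ∈ S r → x ∈ S s → r ≡ s) →
  ∣ p ∣ ≡ m * c
∣p∣-partition {zero} {n} S p size S⊆p cover disj =
  trans (cong ∣_∣ (Empty-unique λ (x , x∈p) → contradiction (proj₁ (cover x∈p)) λ ()))
        (∣⊥∣≡0 n)
∣p∣-partition {suc m} {n} {c} S p size S⊆p cover disj = begin
  ∣ p ∣                       ≡⟨ cong ∣_∣ (⊆-antisym p⊆ ⊆p) ⟩
  ∣ S zero ∪ (p ∩ ∁ (S zero)) ∣   ≡⟨ ∣p∪q∣≡∣p∣+∣q∣ _ _ (λ x∈S x∈─ → ∉S₀ x∈─ x∈S) ⟩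
  ∣ S zero ∣ + ∣ p ∩ ∁ (S zero) ∣ ≡⟨ cong₂ _+_ (size zero) rest ⟩
  c + m * c                   ∎
  where
  open ≡-Reasoning
  ∉S₀ : ∀ {x} → x ∈ p ∩ ∁ (S zero) → x ∉ S zero
  ∉S₀ x∈ = x∈∁p⇒x∉p (p∩q⊆q p _ x∈)
  p⊆ : p ⊆ S zero ∪ (p ∩ ∁ (S zero))
  p⊆ {x} x∈p with x ∈? S zero
  ... | yes x∈S = x∈p∪q⁺ (inj₁ x∈S)
  ... | no  x∉S = x∈p∪q⁺ (inj₂ (x∈p∩q⁺ (x∈p , x∉p⇒x∈∁p x∉S)))
  ⊆p : S zero ∪ (p ∩ ∁ (S zero)) ⊆ p
  ⊆p x∈ = [ S⊆p zero , p∩q⊆p p _ ]′ (x∈p∪q⁻ _ _ x∈)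
  rest : ∣ p ∩ ∁ (S zero) ∣ ≡ m * c
  rest = ∣p∣-partition (S ∘ suc) (p ∩ ∁ (S zero)) (size ∘ suc)
    (λ r x∈ → x∈p∩q⁺ (S⊆p (suc r) x∈ , x∉p⇒x∈∁p λ x∈₀ → contradiction (disj x∈₀ x∈) λ ()))
    cover′ (λ x∈ x∈′ → suc-injective (disj x∈ x∈′))
    where
    cover′ : ∀ {x} → x ∈ p ∩ ∁ (S zero) → ∃[ r ] x ∈ S (suc r)
    cover′ x∈ with cover (p∩q⊆p p _ x∈)
    ... | zero  , x∈S = contradiction x∈S (∉S₀ x∈)
    ... | suc r , x∈S = r , x∈S

-- Common neighbours, and spreads described by class maps.

∈common⁺ : ∀ {x y z} (H : Graph n) → Adj H x z → Adj H y z → z ∈ N H x ∩ N H y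
∈common⁺ {x = x} {y = y} H xz yz =
  x∈p∩q⁺ (∈-tabulate⁺ (Adj? H x) xz , ∈-tabulate⁺ (Adj? H y) yz)

∈common⁻ : ∀ {x y z} (H : Graph n) → z ∈ N H x ∩ N H y → Adj H x z × Adj H y z
∈common⁻ {x = x} {y = y} H z∈ with x∈p∩q⁻ (N H x) (N H y) z∈
... | z∈x , z∈y = ∈-tabulate⁻ (Adj? H x) z∈x , ∈-tabulate⁻ (Adj? H y) z∈y

-- A spread of 1-regular cocliques, given by the map cls to the index of the
-- coclique containing a vertex.
record IsMatchingSpread (G : Graph n) (cls : Fin n → Fin m) : Set where
  field
    independent : ∀ {x y} → cls x ≡ cls y → ¬ Adj G x y
    mate        : ∀ x r → cls x ≢ r → ∃[ y ] (Adj G x y × cls y ≡ r)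
    mate-unique : ∀ {x y z} → Adj G x y → Adj G x z → cls y ≡ cls z → y ≡ z

-- Turning the classes of a matching spread of one graph into cliques.

module Merge
  (G F : Graph n) (cls : Fin n → Fin m) (spread : IsMatchingSpread G cls)
  -- `F` is known only through its adjacency, so that the results apply directly to the graph of the
  -- theorem, whose adjacency is phrased differently.
  (F⁺ : ∀ {x y} → x ≢ y → Adj G x y ⊎ cls x ≡ cls y → Adj F x y)
  (F⁻ : ∀ {x y} → Adj F x y → x ≢ y × (Adj G x y ⊎ cls x ≡ cls y))
  {k lam : ℕ} (edgeRegular : IsEdgeRegular G k lam) (n≡ : n ≡ (lam + 2) * m)
  where

  open IsMatchingSpread spread
  open IsEdgeRegular edgeRegular
  open Graph G using () renaming (∼-sym to G-sym; ∼-irrefl to G-irrefl)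
  open Graph F using () renaming (∼-sym to F-sym)

  private
    variable
      x y z : Fin n

  class : Fin m → Subset n
  class r = tabulate λ x → does (cls x ≟ r)

  ∈class⁺ : ∀ {r} → cls x ≡ r → x ∈ class r
  ∈class⁺ {r = r} = ∈-tabulate⁺ λ x → cls x ≟ r

  ∈class⁻ : ∀ {r} → x ∈ class r → cls x ≡ r
  ∈class⁻ {r = r} = ∈-tabulate⁻ λ x → cls x ≟ r

  G⇒≢ : Adj G x y → x ≢ y
  G⇒≢ xy x≡y = G-irrefl x≡y xy

  G⇒F : Adj G x y → Adj F x y
  G⇒F xy = F⁺ (G⇒≢ xy) (inj₁ xy)

  -- Taking mates maps one class injectively to the other: two vertices with the same mate would be
  -- two neighbours of it in a single class.
  ∣class∣-≤ : ∀ r s → ∣ class r ∣ ≤ ∣ class s ∣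
  ∣class∣-≤ r s with r ≟ s
  ... | yes refl = ≤-refl
  ... | no  r≢s  = injective-relation⇒∣p∣≤∣q∣ (Adj G) (class r) (class s) total
    λ x∈ x′∈ xy x′y →
      mate-unique (G-sym xy) (G-sym x′y) (trans (∈class⁻ x∈) (sym (∈class⁻ x′∈)))
    where
    total : ∀ {x} → x ∈ class r → ∃[ y ] (y ∈ class s × Adj G x y)
    total {x} x∈ with mate x s (λ x≡s → r≢s (trans (sym (∈class⁻ x∈)) x≡s))
    ... | y , xy , y≡s = y , ∈class⁺ y≡s , xy

  ∣class∣≡ : ∀ r → ∣ class r ∣ ≡ lam + 2
  -- The `m` classes are equally large and cover all `n` vertices; `m` may be cancelled because `r`
  -- inhabits `Fin m`.
  ∣class∣≡ r = ℕ.*-cancelˡ-≡ _ _ m {{nonZeroIndex r}} (begin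
    m * ∣ class r ∣ ≡⟨ ∣p∣-partition class ⊤ (λ s → ≤-antisym (∣class∣-≤ s r) (∣class∣-≤ r s))
                         (λ _ _ → ∈⊤) (λ {x} _ → cls x , ∈class⁺ refl)
                         (λ x∈r x∈s → trans (sym (∈class⁻ x∈r)) (∈class⁻ x∈s)) ⟨
    ∣ ⊤ {n} ∣       ≡⟨ ∣⊤∣≡n n ⟩
    n               ≡⟨ n≡ ⟩
    (lam + 2) * m   ≡⟨ ℕ.*-comm (lam + 2) m ⟩
    m * (lam + 2)   ∎)
    where open ≡-Reasoning

  -- The closed neighbourhood of `x` in `F` splits into its neighbours in `G` and its class, which
  -- contains `x`. Counting the closed neighbourhood avoids a subtraction.
  F-regular : IsRegular F (k + lam + 1)
  F-regular x = ℕ.suc-injective (begin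
    suc ∣ N F x ∣                 ≡⟨ ∣⁅x⁆∪p∣≡1+∣p∣ (N F x) x∉ ⟨
    ∣ ⁅ x ⁆ ∪ N F x ∣             ≡⟨ cong ∣_∣ (⊆-antisym ⊆₁ ⊆₂) ⟩
    ∣ N G x ∪ class (cls x) ∣     ≡⟨ ∣p∪q∣≡∣p∣+∣q∣ _ _ (λ y∈ y∈′ → independent
                                       (sym (∈class⁻ y∈′)) (∈-tabulate⁻ (Adj? G x) y∈)) ⟩
    ∣ N G x ∣ + ∣ class (cls x) ∣ ≡⟨ cong₂ _+_ (regular x) (∣class∣≡ (cls x)) ⟩
    k + (lam + 2)                 ≡⟨ +-assoc k lam 2 ⟨
    k + lam + 2                   ≡⟨ +-suc (k + lam) 1 ⟩
    suc (k + lam + 1)             ∎)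
    where
    open ≡-Reasoning
    x∉ : x ∉ N F x
    x∉ x∈ = proj₁ (F⁻ (∈-tabulate⁻ (Adj? F x) x∈)) refl
    ⊆₁ : ⁅ x ⁆ ∪ N F x ⊆ N G x ∪ class (cls x)
    ⊆₁ y∈ with x∈p∪q⁻ ⁅ x ⁆ (N F x) y∈
    ... | inj₁ y∈₁ = x∈p∪q⁺ (inj₂ (∈class⁺ (cong cls (x∈⁅y⁆⇒x≡y x y∈₁))))
    ... | inj₂ y∈₂ with F⁻ (∈-tabulate⁻ (Adj? F x) y∈₂)
    ...   | _ , inj₁ xy  = x∈p∪q⁺ (inj₁ (∈-tabulate⁺ (Adj? G x) xy))
    ...   | _ , inj₂ x≡y = x∈p∪q⁺ (inj₂ (∈class⁺ (sym x≡y)))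
    ⊆₂ : N G x ∪ class (cls x) ⊆ ⁅ x ⁆ ∪ N F x
    ⊆₂ {y} y∈ with x ≟ y | x∈p∪q⁻ (N G x) (class (cls x)) y∈
    ... | yes refl | _ = x∈p∪q⁺ (inj₁ (x∈⁅x⁆ x))
    ... | no  x≢y  | inj₁ y∈₁ =
      x∈p∪q⁺ (inj₂ (∈-tabulate⁺ (Adj? F x) (G⇒F (∈-tabulate⁻ (Adj? G x) y∈₁))))
    ... | no  x≢y  | inj₂ y∈₂ =
      x∈p∪q⁺ (inj₂ (∈-tabulate⁺ (Adj? F x) (F⁺ x≢y (inj₂ (sym (∈class⁻ y∈₂))))))

  -- No common neighbour is gained: if `z` is adjacent to `x` in `G` and shares the class of `y`,
  -- then `z` and `y` are both the mate of `x` in that class, so they coincide. The case with `x`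
  -- and `y` exchanged is the same.
  F-common-adjacent : Adj G x y → commonNeighbours F x y ≡ lam
  F-common-adjacent {x} {y} xy = trans (cong ∣_∣ (⊆-antisym ⊆₁ ⊆₂)) (common x y xy)
    where
    ⊆₁ : N F x ∩ N F y ⊆ N G x ∩ N G y
    ⊆₁ z∈ with ∈common⁻ F z∈
    ... | xz , yz with F⁻ xz | F⁻ yz
    ...   | _ , inj₁ xz′ | _   , inj₁ yz′ = ∈common⁺ G xz′ yz′
    ...   | _ , inj₁ xz′ | y≢z , inj₂ y≡z = contradiction (mate-unique xy xz′ y≡z) y≢z
    ...   | x≢z , inj₂ x≡z | _ , inj₁ yz′ = contradiction (mate-unique (G-sym xy) yz′ x≡z) x≢z
    ...   | _ , inj₂ x≡z | _   , inj₂ y≡z = contradiction xy (independent (trans x≡z (sym y≡z)))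
    ⊆₂ : N G x ∩ N G y ⊆ N F x ∩ N F y
    ⊆₂ z∈ with ∈common⁻ G z∈
    ... | xz , yz = ∈common⁺ F (G⇒F xz) (G⇒F yz)

  -- The common neighbours are the remaining vertices of the class: one outside it would have two
  -- neighbours in the class, against uniqueness of mates. This is where the class size `lam + 2`
  -- fits the parameter `lam`.
  F-common-classmates : x ≢ y → cls x ≡ cls y → commonNeighbours F x y ≡ lam
  F-common-classmates {x} {y} x≢y cls≡ = ℕ.suc-injective (ℕ.suc-injective (begin
    suc (suc ∣ N F x ∩ N F y ∣)         ≡⟨ cong suc (∣⁅x⁆∪p∣≡1+∣p∣ (N F x ∩ N F y) y∉) ⟨
    suc ∣ ⁅ y ⁆ ∪ (N F x ∩ N F y) ∣     ≡⟨ ∣⁅x⁆∪p∣≡1+∣p∣ _ x∉ ⟨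
    ∣ ⁅ x ⁆ ∪ (⁅ y ⁆ ∪ (N F x ∩ N F y)) ∣ ≡⟨ cong ∣_∣ (⊆-antisym ⊆₁ ⊆₂) ⟩
    ∣ class (cls x) ∣                   ≡⟨ ∣class∣≡ (cls x) ⟩
    lam + 2                             ≡⟨ +-comm lam 2 ⟩
    suc (suc lam)                       ∎))
    where
    open ≡-Reasoning
    y∉ : y ∉ N F x ∩ N F y
    y∉ y∈ = proj₁ (F⁻ (proj₂ (∈common⁻ F y∈))) refl
    x∉ : x ∉ ⁅ y ⁆ ∪ (N F x ∩ N F y)
    x∉ x∈ with x∈p∪q⁻ ⁅ y ⁆ _ x∈
    ... | inj₁ x∈₁ = x≢y (x∈⁅y⁆⇒x≡y y x∈₁)
    ... | inj₂ x∈₂ = proj₁ (F⁻ (proj₁ (∈common⁻ F x∈₂))) refl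
    ⊆₁ : ⁅ x ⁆ ∪ (⁅ y ⁆ ∪ (N F x ∩ N F y)) ⊆ class (cls x)
    ⊆₁ z∈ with x∈p∪q⁻ ⁅ x ⁆ _ z∈
    ... | inj₁ z∈₁ = ∈class⁺ (cong cls (x∈⁅y⁆⇒x≡y x z∈₁))
    ... | inj₂ z∈₂ with x∈p∪q⁻ ⁅ y ⁆ _ z∈₂
    ...   | inj₁ z∈₃ = ∈class⁺ (trans (cong cls (x∈⁅y⁆⇒x≡y y z∈₃)) (sym cls≡))
    ...   | inj₂ z∈₄ with ∈common⁻ F z∈₄
    ...     | xz , yz with F⁻ xz | F⁻ yz
    ...       | _ , inj₂ x≡z | _ = ∈class⁺ (sym x≡z)
    ...       | _ , inj₁ xz′ | _ , inj₁ yz′ =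
      contradiction (mate-unique (G-sym xz′) (G-sym yz′) cls≡) x≢y
    ...       | _ , inj₁ xz′ | _ , inj₂ y≡z = contradiction xz′ (independent (trans cls≡ y≡z))
    ⊆₂ : class (cls x) ⊆ ⁅ x ⁆ ∪ (⁅ y ⁆ ∪ (N F x ∩ N F y))
    ⊆₂ {z} z∈ with x ≟ z | y ≟ z
    ... | yes refl | _        = x∈p∪q⁺ (inj₁ (x∈⁅x⁆ x))
    ... | no  _    | yes refl = x∈p∪q⁺ (inj₂ (x∈p∪q⁺ (inj₁ (x∈⁅x⁆ y))))
    ... | no  x≢z  | no  y≢z  = x∈p∪q⁺ (inj₂ (x∈p∪q⁺ (inj₂ (∈common⁺ F
      (F⁺ x≢z (inj₂ (sym (∈class⁻ z∈))))
      (F⁺ y≢z (inj₂ (trans (sym cls≡) (sym (∈class⁻ z∈)))))))))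

  -- Besides the common neighbours in G there are the neighbour of x in the class
  -- of y and the neighbour of y in the class of x.
  F-common-nonadjacent : cls x ≢ cls y → ¬ Adj G x y →
                         commonNeighbours F x y ≡ 2 + commonNeighbours G x y
  F-common-nonadjacent {x} {y} cls≢ ¬xy
    with mate x (cls y) cls≢ | mate y (cls x) (cls≢ ∘ sym)
  ... | p , xp , p≡y | q , yq , q≡x = begin
    ∣ N F x ∩ N F y ∣                       ≡⟨ cong ∣_∣ (⊆-antisym ⊆₁ ⊆₂) ⟩
    ∣ ⁅ p ⁆ ∪ (⁅ q ⁆ ∪ (N G x ∩ N G y)) ∣   ≡⟨ ∣⁅x⁆∪p∣≡1+∣p∣ _ p∉ ⟩
    suc ∣ ⁅ q ⁆ ∪ (N G x ∩ N G y) ∣         ≡⟨ cong suc (∣⁅x⁆∪p∣≡1+∣p∣ _ q∉) ⟩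
    suc (suc ∣ N G x ∩ N G y ∣)             ∎
    where
    open ≡-Reasoning
    q∉ : q ∉ N G x ∩ N G y
    q∉ q∈ = independent (sym q≡x) (proj₁ (∈common⁻ G q∈))
    p∉ : p ∉ ⁅ q ⁆ ∪ (N G x ∩ N G y)
    p∉ p∈ with x∈p∪q⁻ ⁅ q ⁆ _ p∈
    ... | inj₁ p∈₁ = cls≢ (trans (sym q≡x) (trans (cong cls (sym (x∈⁅y⁆⇒x≡y q p∈₁))) p≡y))
    ... | inj₂ p∈₂ = independent (sym p≡y) (proj₂ (∈common⁻ G p∈₂))
    ⊆₁ : N F x ∩ N F y ⊆ ⁅ p ⁆ ∪ (⁅ q ⁆ ∪ (N G x ∩ N G y))
    ⊆₁ {z} z∈ with ∈common⁻ F z∈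
    ... | xz , yz with F⁻ xz | F⁻ yz
    ...   | _ , inj₁ xz′ | _ , inj₁ yz′ = x∈p∪q⁺ (inj₂ (x∈p∪q⁺ (inj₂ (∈common⁺ G xz′ yz′))))
    ...   | _ , inj₁ xz′ | _ , inj₂ y≡z = x∈p∪q⁺ (inj₁
      (subst (λ w → z ∈ ⁅ w ⁆) (mate-unique xz′ xp (trans (sym y≡z) (sym p≡y))) (x∈⁅x⁆ z)))
    ...   | _ , inj₂ x≡z | _ , inj₁ yz′ = x∈p∪q⁺ (inj₂ (x∈p∪q⁺ (inj₁
      (subst (λ w → z ∈ ⁅ w ⁆) (mate-unique yz′ yq (trans (sym x≡z) (sym q≡x))) (x∈⁅x⁆ z)))))
    ...   | _ , inj₂ x≡z | _ , inj₂ y≡z = contradiction (trans x≡z (sym y≡z)) cls≢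
    ⊆₂ : ⁅ p ⁆ ∪ (⁅ q ⁆ ∪ (N G x ∩ N G y)) ⊆ N F x ∩ N F y
    ⊆₂ z∈ with x∈p∪q⁻ ⁅ p ⁆ _ z∈
    ... | inj₁ z∈₁ with refl ← x∈⁅y⁆⇒x≡y p z∈₁ =
      -- `p` differs from `y` because `x` is adjacent to `p` but not to `y`.
      ∈common⁺ F (G⇒F xp) (F⁺ (λ { refl → ¬xy xp }) (inj₂ (sym p≡y)))
    ... | inj₂ z∈₂ with x∈p∪q⁻ ⁅ q ⁆ _ z∈₂
    ...   | inj₁ z∈₃ with refl ← x∈⁅y⁆⇒x≡y q z∈₃ =
      ∈common⁺ F (F⁺ (λ { refl → ¬xy (G-sym yq) }) (inj₂ (sym q≡x))) (G⇒F yq)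
    ...   | inj₂ z∈₄ with ∈common⁻ G z∈₄
    ...     | xz , yz = ∈common⁺ F (G⇒F xz) (G⇒F yz)

  F-edgeRegular : IsEdgeRegular F (k + lam + 1) lam
  F-edgeRegular = record
    { regular = F-regular
    ; hasEdge = let x , y , xy = hasEdge in x , y , G⇒F xy
    ; common  = λ x y xy → let x≢y , adj = F⁻ xy in
                  [ F-common-adjacent , F-common-classmates x≢y ]′ adj
    }

  class-isClique : ∀ r → IsClique F (class r)
  class-isClique r x y x∈ y∈ x≢y =
    F⁺ x≢y (inj₂ (trans (∈class⁻ x∈) (sym (∈class⁻ y∈))))

  class-regular : ∀ r x → x ∉ class r → ∣ N F x ∩ class r ∣ ≡ 1
  class-regular r x x∉ with mate x r (x∉ ∘ ∈class⁺)
  ... | y , xy , y≡r = trans (cong ∣_∣ (⊆-antisym ⊆₁ ⊆₂)) (∣⁅x⁆∣≡1 y)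
    where
    ⊆₁ : N F x ∩ class r ⊆ ⁅ y ⁆
    ⊆₁ {z} z∈ with x∈p∩q⁻ (N F x) _ z∈
    ... | xz , z∈r with F⁻ (∈-tabulate⁻ (Adj? F x) xz)
    ...   | _ , inj₁ xz′ = subst (λ w → z ∈ ⁅ w ⁆)
      (mate-unique xz′ xy (trans (∈class⁻ z∈r) (sym y≡r))) (x∈⁅x⁆ z)
    ...   | _ , inj₂ x≡z = contradiction (∈class⁺ (trans x≡z (∈class⁻ z∈r))) x∉
    ⊆₂ : ⁅ y ⁆ ⊆ N F x ∩ class r
    ⊆₂ z∈ with refl ← x∈⁅y⁆⇒x≡y y z∈ =
      x∈p∩q⁺ (∈-tabulate⁺ (Adj? F x) (G⇒F xy) , ∈class⁺ y≡r)

  F-notComplete : ¬ IsComplete F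
  F-notComplete complete with hasEdge
  -- In a complete graph `x` would be adjacent to the whole class of `y`, which has at least two
  -- vertices, while only one neighbour there is allowed.
  ... | x , y , xy = m+1+n≰m 1 (≤-trans (ℕ.m≤n+m 2 lam) (subst₂ _≤_
      (∣class∣≡ (cls y)) (class-regular (cls y) x x∉) (p⊆q⇒∣p∣≤∣q∣ ⊆)))
    where
    x∉ : x ∉ class (cls y)
    x∉ x∈ = independent (∈class⁻ x∈) xy
    ⊆ : class (cls y) ⊆ N F x ∩ class (cls y)
    ⊆ {z} z∈ = x∈p∩q⁺
      (∈-tabulate⁺ (Adj? F x) (complete x z (λ { refl → x∉ z∈ })) , z∈)

  F-isNeumaier : IsNeumaier F (k + lam + 1) lam 1 (lam + 2)
  F-isNeumaier = record
    { notComplete   = F-notComplete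
    ; edgeRegular   = F-edgeRegular
    ; regularClique =
        let r = cls (proj₁ hasEdge) in
        class r , class-isClique r , (s≤s z≤n , class-regular r) , ∣class∣≡ r
    }

  -- Consequences of strong regularity of the merged graph.

  -- All pairs that are non-adjacent in `F` have `mu` common neighbours there, two more than in `G`.
  -- The pair `u`, `w` forces `mu` to be 2, which leaves none in `G` for any other such pair.
  stronglyRegular⇒no-common-neighbours :
    IsStronglyRegular F →
    ∀ {u w} → cls u ≢ cls w → ¬ Adj G u w → (∀ z → Adj G u z → ¬ Adj G w z) →
    ∀ {x y} → cls x ≢ cls y → ¬ Adj G x y → ∀ z → Adj G x z → ¬ Adj G y z
  stronglyRegular⇒no-common-neighbours (_ , mu , coEdge) {u} {w}
    u≢w ¬uw far {x} {y} x≢y ¬xy z xz yz =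
    n≮n 0 (subst (0 <_) common≡0 (x∈p⇒∣p∣>0 (∈common⁺ G xz yz)))
    where
    open ≡-Reasoning
    F-common : ∀ {x y} → cls x ≢ cls y → ¬ Adj G x y → 2 + commonNeighbours G x y ≡ mu
    F-common {x} {y} x≢y ¬xy = trans (sym (F-common-nonadjacent x≢y ¬xy))
      (IsCoEdgeRegular.common coEdge x y (x≢y ∘ cong cls)
        ([ ¬xy , x≢y ]′ ∘ proj₂ ∘ F⁻))
    common≡0 : commonNeighbours G x y ≡ 0
    common≡0 = ℕ.+-cancelˡ-≡ 2 _ _ (begin
      2 + commonNeighbours G x y ≡⟨ F-common x≢y ¬xy ⟩
      mu                         ≡⟨ F-common u≢w ¬uw ⟨
      2 + commonNeighbours G u w ≡⟨ cong (λ p → 2 + ∣ p ∣) (Empty-unique λ (z , z∈) →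
                                      uncurry (far z) (∈common⁻ G z∈)) ⟩
      2 + ∣ ⊥ {n} ∣              ≡⟨ cong (2 +_) (∣⊥∣≡0 n) ⟩
      2 + 0                      ∎)

  -- Adjacency in `G` becomes transitive on distinct vertices, so every walk contracts to a single
  -- edge or to a point.
  stronglyRegular⇒disjointUnion :
    IsStronglyRegular F →
    ∀ {u w} → cls u ≢ cls w → ¬ Adj G u w → (∀ z → Adj G u z → ¬ Adj G w z) →
    IsDisjointUnionOfCompleteGraphs G
  stronglyRegular⇒disjointUnion srg u≢w ¬uw far x y x≢y (_ , walk) =
    [ (λ x≡y → contradiction x≡y x≢y) , (λ xy → xy) ]′ (walk⇒ walk)
    where
    transitive : ∀ {x y z} → Adj G x y → Adj G y z → x ≢ z → Adj G x z
    transitive {x} {y} {z} xy yz x≢z with Adj? G x z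
    ... | yes xz = xz
    -- `y` is a common neighbour of `x` and `z`, which lie in different classes because distinct
    -- neighbours of `y` do.
    ... | no ¬xz = contradiction (G-sym yz)
      (stronglyRegular⇒no-common-neighbours srg u≢w ¬uw far
        (λ x≡z → x≢z (mate-unique (G-sym xy) yz x≡z)) ¬xz y xy)
    walk⇒ : ∀ {x y d} → Walk G x y d → x ≡ y ⊎ Adj G x y
    walk⇒ stop = inj₁ refl
    walk⇒ {x} {y} (step xz walk) with walk⇒ walk
    ... | inj₁ refl = inj₂ xz
    ... | inj₂ zy with x ≟ y
    ...   | yes x≡y = inj₁ x≡y
    ...   | no  x≢y = inj₂ (transitive xz zy x≢y)

-- The disjoint union of the given graphs.

module DisjointUnion {v t : ℕ} (Γ : Fin t → Graph v) where

  split : Fin (v * t) → Fin v × Fin t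
  split = remQuot t

  split-injective : ∀ {x y} → split x ≡ split y → x ≡ y
  split-injective {x} {y} eq = trans (sym (combine-remQuot {v} t x))
    (trans (cong (uncurry combine) eq) (combine-remQuot {v} t y))

  PairAdj : Fin v × Fin t → Fin v × Fin t → Set
  PairAdj (a , i) (b , j) = i ≡ j × Adj (Γ i) a b

  PairAdj? : ∀ p q → Dec (PairAdj p q)
  PairAdj? (a , i) (b , j) = i ≟ j ×-dec Adj? (Γ i) a b

  PairAdj-sym : ∀ {p q} → PairAdj p q → PairAdj q p
  PairAdj-sym (refl , ab) = refl , Graph.∼-sym (Γ _) ab

  ⨆ : Graph (v * t)
  ⨆ = record
    { _∼_      = λ x y → PairAdj (split x) (split y)
    ; _∼?_     = λ x y → PairAdj? (split x) (split y)
    ; ∼-sym    = PairAdj-sym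
    ; ∼-irrefl = λ { refl (_ , xx) → Graph.∼-irrefl (Γ _) refl xx }
    }

  ⨆⁺ : ∀ i {a b} → Adj (Γ i) a b → Adj ⨆ (combine a i) (combine b i)
  ⨆⁺ i {a} {b} ab =
    subst₂ PairAdj (sym (remQuot-combine a i)) (sym (remQuot-combine b i)) (refl , ab)

  ⨆⁻ : ∀ i {a b} → Adj ⨆ (combine a i) (combine b i) → Adj (Γ i) a b
  ⨆⁻ i {a} {b} ab = proj₂ (subst₂ PairAdj (remQuot-combine a i) (remQuot-combine b i) ab)

  -- Edges never leave a copy. The neighbour is presented through `combine`, so that matching on the
  -- equation replaces `z` by a vertex of copy `i`.
  ⨆-neighbour : ∀ i {a z} → Adj ⨆ (combine a i) z → ∃[ b ] (combine b i ≡ z × Adj (Γ i) a b)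
  ⨆-neighbour i {a} {z} az
    with i≡j , ab ← subst (λ p → PairAdj p (split z)) (remQuot-combine a i) az =
    _ , trans (cong (combine {v} _) i≡j) (combine-remQuot {v} t z) , ab

  -- The embedding of `Γ i` as copy `i` is injective, hence preserves sizes. This carries degrees
  -- and common neighbour counts over to the union.
  ∣p∣-component : ∀ i (p : Subset v) (q : Subset (v * t)) →
                  (∀ {a} → a ∈ p → combine a i ∈ q) →
                  (∀ {z} → z ∈ q → ∃[ a ] (combine a i ≡ z × a ∈ p)) →
                  ∣ q ∣ ≡ ∣ p ∣
  ∣p∣-component i p q to from = ≤-antisym
    (injective-relation⇒∣p∣≤∣q∣ (λ z a → combine a i ≡ z) q p
      (λ z∈ → let a , eq , a∈ = from z∈ in a , a∈ , eq)
      (λ { _ _ refl refl → refl }))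
    (injective-relation⇒∣p∣≤∣q∣ (λ a z → combine a i ≡ z) p q
      (λ a∈ → _ , to a∈ , refl)
      (λ { {a} {a′} _ _ refl eq → sym (combine-injectiveˡ a′ i a i eq) }))

  ⨆-degree : ∀ i a → degree ⨆ (combine a i) ≡ degree (Γ i) a
  ⨆-degree i a = ∣p∣-component i _ _
    (∈-tabulate⁺ (Adj? ⨆ (combine a i)) ∘ ⨆⁺ i ∘ ∈-tabulate⁻ (Adj? (Γ i) a))
    (λ z∈ → let b , eq , ab = ⨆-neighbour i (∈-tabulate⁻ (Adj? ⨆ (combine a i)) z∈) in
            b , eq , ∈-tabulate⁺ (Adj? (Γ i) a) ab)

  ⨆-common : ∀ i a b →
    commonNeighbours ⨆ (combine a i) (combine b i) ≡ commonNeighbours (Γ i) a b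
  ⨆-common i a b = ∣p∣-component i _ _ to from
    where
    to : ∀ {c} → c ∈ N (Γ i) a ∩ N (Γ i) b → combine c i ∈ N ⨆ (combine a i) ∩ N ⨆ (combine b i)
    to c∈ = let ac , bc = ∈common⁻ (Γ i) c∈ in ∈common⁺ ⨆ (⨆⁺ i ac) (⨆⁺ i bc)
    from : ∀ {z} → z ∈ N ⨆ (combine a i) ∩ N ⨆ (combine b i) →
           ∃[ c ] (combine c i ≡ z × c ∈ N (Γ i) a ∩ N (Γ i) b)
    from z∈ with ∈common⁻ ⨆ z∈
    ... | az , bz with ⨆-neighbour i az
    ...   | c , refl , ac = c , refl , ∈common⁺ (Γ i) ac (⨆⁻ i bz)

  ⨆-edgeRegular : ∀ {k lam} → Fin t → (∀ i → IsEdgeRegular (Γ i) k lam) → IsEdgeRegular ⨆ k lam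
  ⨆-edgeRegular {k} {lam} i₀ edgeRegular = record
    { regular = regular
    ; hasEdge = let a , b , ab = IsEdgeRegular.hasEdge (edgeRegular i₀) in
                combine a i₀ , combine b i₀ , ⨆⁺ i₀ ab
    ; common  = common
    }
    where
    regular : IsRegular ⨆ k
    regular x = subst (λ x → degree ⨆ x ≡ k) (combine-remQuot {v} t x)
      (let a , i = split x in
       trans (⨆-degree i a) (IsEdgeRegular.regular (edgeRegular i) a))
    common-combine : ∀ a i y → Adj ⨆ (combine a i) y → commonNeighbours ⨆ (combine a i) y ≡ lam
    common-combine a i y ay with ⨆-neighbour i ay
    ... | b , refl , ab = trans (⨆-common i a b) (IsEdgeRegular.common (edgeRegular i) a b ab)
    common : ∀ x y → Adj ⨆ x y → commonNeighbours ⨆ x y ≡ lam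
    -- Every vertex has the form `combine a i`, which reduces the claim to `common-combine`.
    common x y = subst (λ x → Adj ⨆ x y → commonNeighbours ⨆ x y ≡ lam)
      (combine-remQuot {v} t x) (uncurry common-combine (split x) y)

  ⨆-walk : ∀ i {a b d} → Walk (Γ i) a b d → Walk ⨆ (combine a i) (combine b i) d
  ⨆-walk i stop           = stop
  ⨆-walk i (step ab walk) = step (⨆⁺ i ab) (⨆-walk i walk)

  component-isDisjointUnion : IsDisjointUnionOfCompleteGraphs ⨆ →
                              ∀ i → IsDisjointUnionOfCompleteGraphs (Γ i)
  component-isDisjointUnion disjointUnion i a b a≢b (d , walk) = ⨆⁻ i
    (disjointUnion _ _ (a≢b ∘ combine-injectiveˡ a i b i) (d , ⨆-walk i walk))

-- The merged cocliques, and the graph of the theorem as a merged graph.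

module MergedSpread {v t m : ℕ} (Γ : Fin t → Graph v) (C : Fin t → Fin m → Subset v)
  (spread : ∀ i → IsSpreadOfRegularCocliques (Γ i) 1 (C i)) (π : Fin t → Permutation′ m)
  where

  open DisjointUnion Γ

  index : Fin t → Fin v → Fin m
  index i a = proj₁ (proj₂ (proj₁ (spread i)) a)

  ∈-index : ∀ i a → a ∈ C i (index i a)
  ∈-index i a = proj₁ (proj₂ (proj₂ (proj₁ (spread i)) a))

  index-unique : ∀ {i a j} → a ∈ C i j → index i a ≡ j
  index-unique {i} {a} a∈ = proj₂ (proj₂ (proj₂ (proj₁ (spread i)) a)) a∈

  coclique : ∀ i {a b} → index i a ≡ index i b → ¬ Adj (Γ i) a b
  coclique i {a} {b} eq = proj₁ (proj₂ (spread i) (index i b)) a b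
    (subst (λ j → a ∈ C i j) eq (∈-index i a)) (∈-index i b)

  ∣N∩C∣≡1 : ∀ i {a j} → a ∉ C i j → ∣ N (Γ i) a ∩ C i j ∣ ≡ 1
  ∣N∩C∣≡1 i {a} {j} = proj₂ (proj₂ (proj₂ (spread i) j)) a

  -- The merged coclique with index `r` meets copy `i` in `C i (π i ⟨$⟩ʳ r)`, so the inverse
  -- permutation recovers `r`.
  pairClass : Fin v × Fin t → Fin m
  pairClass (a , i) = π i ⟨$⟩ˡ index i a

  pairClass≡⇒index≡ : ∀ {i a b} → pairClass (a , i) ≡ pairClass (b , i) → index i a ≡ index i b
  pairClass≡⇒index≡ {i} eq =
    trans (sym (inverseʳ (π i))) (trans (cong (π i ⟨$⟩ʳ_) eq) (inverseʳ (π i)))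

  ∈C⇒pairClass : ∀ {i a r} → a ∈ C i (π i ⟨$⟩ʳ r) → pairClass (a , i) ≡ r
  ∈C⇒pairClass {i} a∈ = trans (cong (π i ⟨$⟩ˡ_) (index-unique a∈)) (inverseˡ (π i))

  cls : Fin (v * t) → Fin m
  cls = pairClass ∘ split

  cls-combine : ∀ a i → cls (combine a i) ≡ pairClass (a , i)
  cls-combine a i = cong pairClass (remQuot-combine a i)

  cls≡⇒index≡ : ∀ {i a b} → cls (combine a i) ≡ cls (combine b i) → index i a ≡ index i b
  cls≡⇒index≡ {i} {a} {b} eq =
    pairClass≡⇒index≡ (trans (sym (cls-combine a i)) (trans eq (cls-combine b i)))

  -- A merged coclique contains exactly one coclique of each copy, and edges stay within a copy, so
  -- everything reduces to the 1-regular cocliques of a single `Γ i`.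
  isMatchingSpread : IsMatchingSpread ⨆ cls
  isMatchingSpread = record
    { independent = λ {x} {y} → independent (split x) (split y)
    ; mate        = λ x → mate (split x)
    ; mate-unique = λ {x} {y} {z} xy xz y≡z →
        split-injective (mate-unique (split x) (split y) (split z) xy xz y≡z)
    }
    where
    independent : ∀ p q → pairClass p ≡ pairClass q → ¬ PairAdj p q
    independent (_ , i) _ eq (refl , ab) = coclique i (pairClass≡⇒index≡ eq) ab
    mate : ∀ p r → pairClass p ≢ r → ∃[ y ] (PairAdj p (split y) × cls y ≡ r)
    mate (a , i) r a≢r with ∣p∣≡1⇒Nonempty (∣N∩C∣≡1 i (a≢r ∘ ∈C⇒pairClass))
    ... | b , b∈ with x∈p∩q⁻ (N (Γ i) a) _ b∈
    ...   | ab , b∈C = combine b i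
      , subst (PairAdj (a , i)) (sym (remQuot-combine b i)) (refl , ∈-tabulate⁻ (Adj? (Γ i) a) ab)
      , trans (cls-combine b i) (∈C⇒pairClass b∈C)
    mate-unique : ∀ p q r → PairAdj p q → PairAdj p r → pairClass q ≡ pairClass r → q ≡ r
    mate-unique (a , i) (b , _) (c , _) (refl , ab) (refl , ac) eq = cong (_, i)
      -- Both `b` and `c` are neighbours of `a` in the coclique of `b`. It does not contain `a`,
      -- being independent, so 1-regularity applies.
      (∣p∣≡1⇒unique (∣N∩C∣≡1 i (λ a∈ → coclique i (index-unique a∈) ab))
        (x∈p∩q⁺ (∈-tabulate⁺ (Adj? (Γ i) a) ab , ∈-index i b))
        (x∈p∩q⁺ (∈-tabulate⁺ (Adj? (Γ i) a) ac ,
          subst (λ j → c ∈ C i j) (sym (pairClass≡⇒index≡ eq)) (∈-index i c))))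

  F⁺ : ∀ {x y} → x ≢ y → Adj ⨆ x y ⊎ cls x ≡ cls y → Adj (F Γ C π) x y
  F⁺ x≢y (inj₁ xy) = x≢y ∘ split-injective , inj₁ xy
  F⁺ {x} {y} x≢y (inj₂ x≡y) = x≢y ∘ split-injective ,
    inj₂ (_ , _ , ∈-index _ _ , ∈-index _ _ , x≡y)

  F⁻ : ∀ {x y} → Adj (F Γ C π) x y → x ≢ y × (Adj ⨆ x y ⊎ cls x ≡ cls y)
  F⁻ (x≢y , inj₁ xy) = x≢y ∘ cong split , inj₁ xy
  F⁻ (x≢y , inj₂ (_ , _ , x∈ , y∈ , eq)) = x≢y ∘ cong split ,
    inj₂ (trans (cong (π _ ⟨$⟩ˡ_) (index-unique x∈))
                (trans eq (cong (π _ ⟨$⟩ˡ_) (sym (index-unique y∈)))))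

  -- Vertices in different classes at distance at least 3.

  FarPair : Set
  FarPair = ∃₂ λ u w → cls u ≢ cls w × ¬ Adj ⨆ u w × (∀ z → Adj ⨆ u z → ¬ Adj ⨆ w z)

  -- Vertices of different copies are non-adjacent and have no common neighbours; only the classes
  -- need care. For an edge `a b` of copy `i`, choose `c` in copy `j` within the class of `b`, which
  -- is not that of `a`.
  different-components⇒FarPair : ∀ {i j a b} → i ≢ j → Adj (Γ i) a b → FarPair
  different-components⇒FarPair {i} {j} {a} {b} i≢j ab = combine a i , combine c j
    , (λ eq → IsMatchingSpread.independent isMatchingSpread (trans eq c≡b) (⨆⁺ i ab))
    , (λ ac → let _ , eq , _ = ⨆-neighbour i ac in disjoint eq)
    , (λ z az cz → let _ , eq , _ = ⨆-neighbour i az; _ , eq′ , _ = ⨆-neighbour j cz in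
                   disjoint (trans eq (sym eq′)))
    where
    disjoint : ∀ {a b : Fin v} → combine a i ≢ combine b j
    disjoint {a} {b} = i≢j ∘ combine-injectiveʳ a i b j
    r : Fin m
    r = cls (combine b i)
    c : Fin v
    c = proj₁ (proj₁ (proj₁ (spread j)) (π j ⟨$⟩ʳ r))
    c≡b : cls (combine c j) ≡ r
    c≡b = trans (cls-combine c j) (∈C⇒pairClass (proj₂ (proj₁ (proj₁ (spread j)) (π j ⟨$⟩ʳ r))))

  -- An edge or a common neighbour would give a walk of length 1 or 2.
  distance≥3⇒FarPair : ∀ {i a b} → DistanceAtLeast 3 (Γ i) a b →
                       ¬ (∃[ j ] (a ∈ C i j × b ∈ C i j)) → FarPair
  distance≥3⇒FarPair {i} {a} {b} dist ¬same = combine a i , combine b i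
    , (λ eq → ¬same
        (index i b , subst (λ j → a ∈ C i j) (cls≡⇒index≡ eq) (∈-index i a) , ∈-index i b))
    , (λ ab → m+1+n≰m 1 (dist (step (⨆⁻ i ab) stop)))
    , far
    where
    far : ∀ z → Adj ⨆ (combine a i) z → ¬ Adj ⨆ (combine b i) z
    far z az bz with ⨆-neighbour i az
    ... | c , refl , ac =
      m+1+n≰m 2 (dist (step ac (step (Graph.∼-sym (Γ i) (⨆⁻ i bz)) stop)))

mainTheorem4 :
  (v k lam t : ℕ) (t≥1 : 1 ≤ t)
  (Γ : Fin t → Graph v) →
  (∀ i → IsEdgeRegular (Γ i) k lam) →
  v * t ≡ (lam + 2) * (k + 1) →
  (C : Fin t → Fin (k + 1) → Subset v) →
  (∀ i → IsSpreadOfRegularCocliques (Γ i) 1 (C i)) →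
  (π : Fin t → Permutation′ (k + 1)) →
  π (fromℕ< t≥1) ≈ id →
  -- Not in the informal statement, which is false without it: if every Γ i
  -- is a disjoint union of complete graphs, then F Γ C π is a square grid
  -- and hence strongly regular (for instance t = 2 and Γ i = 2K₄).
  -- Automatic as soon as some Γ i is connected and not complete.
  ¬ (∀ i → IsDisjointUnionOfCompleteGraphs (Γ i)) →
  ((2 ≤ t × (∀ i → ¬ IsComplete (Γ i)))
   ⊎
   (t ≡ 1 × ∃₂ λ x y →
      DistanceAtLeast 3 (Γ (fromℕ< t≥1)) x y
      × ¬ (∃[ j ] (x ∈ C (fromℕ< t≥1) j × y ∈ C (fromℕ< t≥1) j)))) →
  IsStrictlyNeumaier (F Γ C π) (k + lam + 1) lam 1 (lam + 2)
mainTheorem4 v k lam t t≥1 Γ edgeRegular size C spread π _ ¬disjointUnion cases =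
  F-isNeumaier , notStronglyRegular (farPair cases)
  where
  open MergedSpread Γ C spread π
  open DisjointUnion Γ
  open Merge ⨆ (F Γ C π) cls isMatchingSpread F⁺ F⁻ (⨆-edgeRegular (fromℕ< t≥1) edgeRegular) size
  farPair : _ → FarPair
  -- Matching on `2 ≤ t` makes `zero` and `suc zero` two distinct indices of copies.
  farPair (inj₁ (s≤s (s≤s _) , _)) =
    let _ , _ , ab = IsEdgeRegular.hasEdge (edgeRegular zero) in
    different-components⇒FarPair {zero} {suc zero} (λ ()) ab
  farPair (inj₂ (_ , _ , _ , dist , ¬same)) = distance≥3⇒FarPair dist ¬same
  notStronglyRegular : FarPair → ¬ IsStronglyRegular (F Γ C π)
  -- Strong regularity would make the union, and with it every `Γ i`, a disjoint union of complete
  -- graphs.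
  notStronglyRegular (_ , _ , u≢w , ¬uw , far) stronglyRegular = ¬disjointUnion
    (component-isDisjointUnion (stronglyRegular⇒disjointUnion stronglyRegular u≢w ¬uw far))
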